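{- (a) If $v=2m+1$, then $\mathrm{BHR}(L)$ holds for $L=(L^*\setminus\{m,m\})\cup\{z_1,z_2\}$ for any $1\leq z_1,z_2<m$; in particular such $L$ is the edge-length list of some Hamiltonian path of $K_v$. (b) If $v=2m$, then $\mathrm{BHR}(L)$ holds for $L=(L^*\setminus\{m-1,m-1\})\cup\{z_1,z_2\}$ for any $1\leq z_1,z_2<m-1$; in particular such $L$ is the edge-length list of some Hamiltonian path of $K_v$. (Here $\setminus$ removes the indicated copies and $\cup$ is multiset union.)
   Context: $K_v$ is the complete graph on vertex set $\{0,1,\ldots,v-1\}$; the length of an edge $[x,y]$ is $\min(|x-y|,v-|x-y|)$ and $\ell(H)$ is the multiset of edge lengths of $H$. If $v=2m+1$, $L^*=\{1^2,2^2,\ldots,m^2\}$; if $v=2m$, $L^*=\{1^2,2^2,\ldots,(m-1)^2,m^1\}$, where $i^{a}$ denotes $a$ copies of $i$. For a list $L$ of $v-1$ positive integers not exceeding $\lfloor v/2\rfloor$, $\mathrm{BHR}(L)$ is the statement: there exists a Hamiltonian path $H$ of $K_v$ with $\ell(H)=L$ if and only if for every divisor $d$ of $v$ the number of elements of $L$ (with multiplicity) that are multiples of $d$ is at most $v-d$. -}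

module Defs where

open import Data.Nat using (ℕ; zero; suc; _+_; _*_; _∸_; _≤_; _<_; _⊓_; ∣_-_∣; _≟_)
open import Data.Nat.Divisibility using (_∣_; _∣?_)
open import Data.Fin using (Fin; toℕ)
open import Data.List using (List; []; _∷_; _++_; length; filter; allFin)
open import Data.List.Relation.Binary.Permutation.Propositional using (_↭_)
open import Data.Product using (Σ; _×_; _,_)
open import Relation.Nullary using (yes; no)
open import Function.Bundles using (_⇔_)

edgeLen : (v : ℕ) → Fin v → Fin v → ℕ
edgeLen v x y = ∣ toℕ x - toℕ y ∣ ⊓ (v ∸ ∣ toℕ x - toℕ y ∣)

HamPath : ℕ → Set
HamPath v = Σ (List (Fin v)) (λ p → p ↭ allFin v)

lengths : (v : ℕ) → List (Fin v) → List ℕ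
lengths v [] = []
lengths v (x ∷ []) = []
lengths v (x ∷ y ∷ p) = edgeLen v x y ∷ lengths v (y ∷ p)

ℓ : {v : ℕ} → HamPath v → List ℕ
ℓ {v} (p , _) = lengths v p

Realizable : (v : ℕ) → List ℕ → Set
Realizable v L = Σ (HamPath v) (λ H → ℓ H ↭ L)

countMult : ℕ → List ℕ → ℕ
countMult d L = length (filter (d ∣?_) L)

BHR : ℕ → List ℕ → Set
BHR v L = Realizable v L ⇔ (∀ d → d ∣ v → countMult d L ≤ v ∸ d)

pairsUpTo : ℕ → List ℕ
pairsUpTo zero = []
pairsUpTo (suc k) = pairsUpTo k ++ (suc k ∷ suc k ∷ [])

LstarOdd : ℕ → List ℕ
LstarOdd m = pairsUpTo m

LstarEven : ℕ → List ℕ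
LstarEven m = pairsUpTo (m ∸ 1) ++ (m ∷ [])

delete : ℕ → List ℕ → List ℕ
delete x [] = []
delete x (y ∷ ys) with x ≟ y
... | yes _ = ys
... | no _ = y ∷ delete x ys

replaceTwo : List ℕ → ℕ → ℕ → ℕ → List ℕ
replaceTwo Ls x z₁ z₂ = delete x (delete x Ls) ++ (z₁ ∷ z₂ ∷ [])

{-# OPTIONS --safe #-}
-- A path on the labels 0 .. N whose consecutive differences are 1 .. N (a graceful labelling) can
-- start at any label i.  Given this, cut the cycle Z_v at 0 (v odd), or at 0 and v/2 (v even): the
-- rest falls into two intervals of equal size, each of which is traversed gracefully, starting at
-- distance z₁ or z₂ from the adjacent cut vertex.
-- Graceful paths come from paths alternating between low labels x and high labels N − y: there the
-- difference is N − (x + y), so the sums x + y have to be 0 .. N − 1.  Writing (l, h, i) for such a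
-- path with l low and h high labels and first label i, the prefix i, i−1, i−1, …, 0, 0 reduces
-- (l, h, i) to (h − i, l − i − 1, i), the prefix i, i, …, 0, 0 reduces it to
-- (l − i − 1, h − i − 1, i), and the reflection of both label sets moves i to l − 1 − i.  This
-- settles all l = h and l = h + 1, except l = 2i + 1, h = 2i with i > 0.
module Submission where

open import Defs
open import Data.Empty using (⊥-elim)
open import Data.Fin using (Fin; toℕ; fromℕ<)
open import Data.Fin.Properties using (toℕ<n; toℕ-fromℕ<; toℕ-injective; injective⇒≤)
open import Data.List using (List; []; _∷_; _++_; _ʳ++_; map; length; lookup; filter; allFin;
  tabulate; downFrom; upTo; applyUpTo)
open import Data.List.Properties using (++-assoc; ++-identityʳ; map-++; map-∘; map-id; map-cong;
  map-cong-local; map-tabulate; length-tabulate; ʳ++-defn; reverse-upTo)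
open import Data.List.Membership.Propositional using (_∈_)
open import Data.List.Membership.Propositional.Properties using (∈-allFin)
open import Data.List.Relation.Binary.Permutation.Propositional
open import Data.List.Relation.Binary.Permutation.Propositional.Properties
  using (All-resp-↭; ∈-resp-↭; ↭-map-inv; ↭-length; ↭-reverse; filter-↭;
    map⁺; ++⁺; ++⁺ˡ; ++⁺ʳ; ++-comm; shift)
open import Data.List.Relation.Unary.All as All using (All; []; _∷_)
import Data.List.Relation.Unary.All.Properties as All
open import Data.List.Relation.Unary.Any using (here; there; index)
open import Data.List.Relation.Unary.Any.Properties using (lookup-index)
open import Data.Nat
open import Data.Nat.Divisibility
open import Data.Nat.DivMod using (_%_; %-remove-+ʳ; m<n⇒m%n≡m)
open import Data.Nat.Properties
open import Data.Nat.Tactic.RingSolver using (solve-∀)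
open import Data.Product using (_×_; _,_; ∃)
open import Data.Sum using (_⊎_; inj₁; inj₂)
open import Function using (id; _∘_)
open import Function.Bundles using (mk⇔)
open import Relation.Binary.Definitions using (tri<; tri≈; tri>)
open import Relation.Binary.PropositionalEquality hiding (trans)
import Relation.Binary.PropositionalEquality as ≡
open import Relation.Nullary using (yes; no)
open import Relation.Unary using (U)

-- Alternating lists and the steps between consecutive entries

private variable
  X Y Z : Set
  P Q : X → Set

evens odds : List X → List X
evens [] = []
evens (x ∷ xs) = x ∷ odds xs
odds [] = []
odds (x ∷ xs) = evens xs

alternate : (X → Y) → (X → Y) → List X → List Y
alternate f g [] = []
alternate f g (x ∷ xs) = f x ∷ alternate g f xs

steps : (X → X → Y) → List X → List Y
steps _∙_ [] = []
steps _∙_ (x ∷ []) = []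
steps _∙_ (x ∷ y ∷ xs) = (x ∙ y) ∷ steps _∙_ (y ∷ xs)

evens-alternate : (f g : X → Y) (xs : List X) → evens (alternate f g xs) ≡ map f (evens xs)
odds-alternate : (f g : X → Y) (xs : List X) → odds (alternate f g xs) ≡ map g (odds xs)
evens-alternate f g [] = refl
evens-alternate f g (x ∷ xs) = cong (f x ∷_) (odds-alternate g f xs)
odds-alternate f g [] = refl
odds-alternate f g (x ∷ xs) = evens-alternate g f xs

evens++odds : (xs : List X) → evens xs ++ odds xs ↭ xs
evens++odds [] = refl
evens++odds (x ∷ xs) = prep x (trans (++-comm (odds xs) (evens xs)) (evens++odds xs))

-- The two equations trade places at every recursive call, because the tail starts on the other
-- side. `P` and `Q` are separate since low and high labels have different bounds.
steps-alternate : {_∙_ : X → X → X} {_⊕_ : Y → Y → Y} {f g : X → Y} (h : X → Y) →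
  (∀ {x y} → P x → Q y → f x ⊕ g y ≡ h (x ∙ y)) →
  (∀ {x y} → P x → Q y → g y ⊕ f x ≡ h (y ∙ x)) →
  ∀ {xs} → All P (evens xs) → All Q (odds xs) →
  steps _⊕_ (alternate f g xs) ≡ map h (steps _∙_ xs)
steps-alternate h fg gf {[]} p q = refl
steps-alternate h fg gf {x ∷ []} p q = refl
steps-alternate h fg gf {x ∷ y ∷ xs} (px ∷ p) (qy ∷ q) =
  cong₂ _∷_ (fg px qy)
    (steps-alternate h (λ qy px → gf px qy) (λ qy px → fg px qy) (qy ∷ q) p)

steps-map : {_∙_ : X → X → X} {_⊕_ : Y → Y → Z} {f : X → Y} (h : X → Z) →
  (∀ {x y} → P x → P y → f x ⊕ f y ≡ h (x ∙ y)) →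
  ∀ {xs} → All P xs → steps _⊕_ (map f xs) ≡ map h (steps _∙_ xs)
steps-map h eq [] = refl
steps-map h eq (_ ∷ []) = refl
steps-map h eq (px ∷ py ∷ ps) = cong₂ _∷_ (eq px py) (steps-map h eq (py ∷ ps))

-- Translates and reflections of initial segments

map-+-downFrom : ∀ j k → map (k +_) (downFrom j) ++ downFrom k ≡ downFrom (j + k)
map-+-downFrom zero k = refl
map-+-downFrom (suc j) k = cong₂ _∷_ (+-comm k j) (map-+-downFrom j k)

downFrom-extend : ∀ {xs} j k → xs ↭ downFrom j → downFrom k ++ map (k +_) xs ↭ downFrom (j + k)
downFrom-extend {xs} j k p =
  trans (++-comm (downFrom k) (map (k +_) xs))
    (trans (++⁺ʳ (downFrom k) (map⁺ (k +_) p)) (↭-reflexive (map-+-downFrom j k)))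

-- The extra entry `k` will be the sum on the edge that joins a prefix to the translated rest.
downFrom-extend′ : ∀ {xs} j k → xs ↭ downFrom j →
  downFrom k ++ k ∷ map (suc k +_) xs ↭ downFrom (j + suc k)
downFrom-extend′ {xs} j k p = trans (shift k (downFrom k) _) (downFrom-extend j (suc k) p)

-- The images fill the top `k` values up to `N`, and these begin at `c`. The induction peels off the
-- largest entry, whose image is the smallest.
map-reflect-downFrom : ∀ {N} c k → suc N ≡ c + k →
  map (N ∸_) (downFrom k) ↭ map (c +_) (downFrom k)
map-reflect-downFrom c zero eq = refl
map-reflect-downFrom {N} c (suc k) eq with suc-injective (≡.trans eq (+-suc c k))
... | refl rewrite m+n∸n≡m c k | +-comm c k = begin
    c ∷ map ((k + c) ∸_) (downFrom k)
      ↭⟨ prep c (map-reflect-downFrom (suc c) k (cong suc (+-comm k c))) ⟩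
    c ∷ map (suc c +_) (downFrom k)
      ↭⟨ ++-comm (c ∷ []) _ ⟩
    map (suc c +_) (downFrom k) ++ c ∷ []
      ≡⟨ shifted k ⟩
    map (c +_) (downFrom (suc k))
      ≡⟨ cong (_∷ map (c +_) (downFrom k)) (+-comm c k) ⟩
    k + c ∷ map (c +_) (downFrom k) ∎
  where
  open PermutationReasoning
  shifted : ∀ k → map (suc c +_) (downFrom k) ++ c ∷ [] ≡ map (c +_) (downFrom (suc k))
  shifted zero = cong (_∷ []) (sym (+-identityʳ c))
  shifted (suc k) = cong₂ _∷_ (sym (+-suc c k)) (shifted k)

downFrom-bounded : ∀ n → All (_< n) (downFrom n)
downFrom-bounded n = All.applyDownFrom⁺₁ id n id

bounded : ∀ {n xs} → xs ↭ downFrom n → All (_< n) xs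
bounded {n} p = All-resp-↭ (↭-sym p) (downFrom-bounded n)

-- Sum paths and the two prefixes

record SumPath (l h i : ℕ) : Set where
  constructor sumPath
  field
    {tail} : List ℕ
    {edges} : ℕ
    count : l + h ≡ suc edges
    -- Low labels, the start included, sit at even positions. Only sums matter here, so a high label
    -- N - y is recorded as `y`.
    lows : evens (i ∷ tail) ↭ downFrom l
    highs : odds (i ∷ tail) ↭ downFrom h
    sums : steps _+_ (i ∷ tail) ↭ downFrom edges

ladder : ℕ → List ℕ
ladder zero = []
ladder (suc k) = k ∷ k ∷ ladder k

evens-ladder : ∀ k xs → evens (ladder k ++ xs) ≡ downFrom k ++ evens xs
evens-ladder zero xs = refl
evens-ladder (suc k) xs = cong (k ∷_) (evens-ladder k xs)

odds-ladder : ∀ k xs → odds (ladder k ++ xs) ≡ downFrom k ++ odds xs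
odds-ladder zero xs = refl
odds-ladder (suc k) xs = cong (k ∷_) (odds-ladder k xs)

-- Equal neighbours give the even sums, unequal ones the odd sums. The zigzag ends at 0, so the
-- joining sum is `x` itself.
sums-ladder : ∀ k x xs →
  steps _+_ (k ∷ ladder k ++ x ∷ xs) ≡ downFrom (k + k) ++ x ∷ steps _+_ (x ∷ xs)
sums-ladder zero x xs = refl
sums-ladder (suc k) x xs rewrite +-suc k k =
  cong (λ s → suc (k + k) ∷ (k + k) ∷ s) (sums-ladder k x xs)

sums-shift : ∀ a b xs → steps _+_ (alternate (a +_) (b +_) xs) ≡ map ((a + b) +_) (steps _+_ xs)
sums-shift a b xs = steps-alternate {P = U} {Q = U} ((a + b) +_) (λ {x} {y} _ _ → lemma a b x y)
   (λ {x} {y} _ _ → ≡.trans (lemma b a y x) (cong (_+ (y + x)) (+-comm b a))) (All.universal-U _) (All.universal-U _)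
  where
  lemma : ∀ a b x y → a + x + (b + y) ≡ a + b + (x + y)
  lemma = solve-∀

-- The prefix has the sums 0 ... 2i, and the rest, translated by i + 1 on both sides, has the sums
-- from 2i + 2 on. The edge from 0 to the translated start 2i + 1 supplies the missing sum; this is
-- why the rest starts at `i` again.
prefix-even : ∀ {l h i} → SumPath l h i → SumPath (l + suc i) (h + suc i) i
prefix-even {l} {h} {i} (sumPath {t} {e} c lo hi s) = sumPath
  (≡.trans (lemma l h i) (cong (_+ suc (suc (i + i))) c))
  (trans (↭-reflexive (≡.trans (evens-ladder (suc i) r) (cong (downFrom (suc i) ++_) (evens-alternate _ _ (i ∷ t)))))
    (downFrom-extend l (suc i) lo))
  (trans (↭-reflexive (≡.trans (odds-ladder (suc i) r) (cong (downFrom (suc i) ++_) (odds-alternate _ _ (i ∷ t)))))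
    (downFrom-extend h (suc i) hi))
  (trans (↭-reflexive (≡.trans (cong (i + i ∷_) (sums-ladder i (suc i + i) _))
      (cong (λ q → downFrom (suc (i + i)) ++ suc (i + i) ∷ q)
        (≡.trans (sums-shift (suc i) (suc i) (i ∷ t)) (cong (λ q → map (suc q +_) (steps _+_ (i ∷ t))) (+-suc i i))))))
    (downFrom-extend′ e (suc (i + i)) s))
  where
  r = alternate (suc i +_) (suc i +_) (i ∷ t)
  lemma : ∀ l h i → l + suc i + (h + suc i) ≡ l + h + suc (suc (i + i))
  lemma = solve-∀

-- The prefix has odd length, so the rest enters on the high side and `l` and `h` trade places. Its
-- first side is translated by i and its second by i + 1, so the joining sum 2i lies between the
-- sums of the prefix and those of the rest.
prefix-odd : ∀ {l h i} → SumPath l h i → SumPath (h + suc i) (l + i) i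
prefix-odd {l} {h} {i} (sumPath {t} {e} c lo hi s) = sumPath
  (≡.trans (lemma l h i) (cong (_+ suc (i + i)) c))
  (trans (↭-reflexive (cong (i ∷_) (≡.trans (odds-ladder i r) (cong (downFrom i ++_) (odds-alternate _ _ (i ∷ t))))))
    (downFrom-extend h (suc i) hi))
  (trans (↭-reflexive (≡.trans (evens-ladder i r) (cong (downFrom i ++_) (evens-alternate _ _ (i ∷ t)))))
    (downFrom-extend l i lo))
  (trans (↭-reflexive (≡.trans (sums-ladder i (i + i) _)
      (cong (λ q → downFrom (i + i) ++ (i + i) ∷ q)
        (≡.trans (sums-shift i (suc i) (i ∷ t)) (cong (λ q → map (q +_) (steps _+_ (i ∷ t))) (+-suc i i))))))
    (downFrom-extend′ e (i + i) s))
  where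
  r = alternate (i +_) (suc i +_) (i ∷ t)
  lemma : ∀ l h i → h + suc i + (l + i) ≡ l + h + suc (i + i)
  lemma = solve-∀

single : SumPath 1 0 0
single = sumPath {tail = []} refl refl refl refl

reflect-downFrom : ∀ {xs} n → xs ↭ downFrom (suc n) → map (n ∸_) xs ↭ downFrom (suc n)
reflect-downFrom n p = trans (map⁺ (n ∸_) p)
  (trans (map-reflect-downFrom 0 (suc n) refl) (↭-reflexive (map-id _)))

-- The largest sum is i + j + b. Reversing both label ranges turns a sum s into i + j + b - s, so
-- the sums again fill an initial segment.
reflect : ∀ {i j b} → SumPath (suc (i + j)) (suc b) j → SumPath (suc (i + j)) (suc b) i
reflect {i} {j} {b} (sumPath {t} c lo hi s) with ≡.trans (sym c) (cong suc (+-suc (i + j) b))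
... | refl = subst (SumPath _ _) (m+n∸n≡m i j) (sumPath c
  (trans (↭-reflexive (evens-alternate (i + j ∸_) (b ∸_) (j ∷ t))) (reflect-downFrom (i + j) lo))
  (trans (↭-reflexive (odds-alternate (i + j ∸_) (b ∸_) (j ∷ t))) (reflect-downFrom b hi))
  (trans (↭-reflexive (steps-alternate (i + j + b ∸_) sum (λ {x} {y} p q → ≡.trans (+-comm (b ∸ y) _)
      (≡.trans (sum p q) (cong (i + j + b ∸_) (+-comm x y)))) (bounded lo) (bounded hi)))
    (reflect-downFrom (i + j + b) s)))
  where
  sum : ∀ {x y} → x < suc (i + j) → y < suc b → (i + j ∸ x) + (b ∸ y) ≡ i + j + b ∸ (x + y)
  sum {x} {y} (s≤s p) (s≤s q) = sym (begin
    i + j + b ∸ (x + y)     ≡⟨ ∸-+-assoc (i + j + b) x y ⟨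
    i + j + b ∸ x ∸ y       ≡⟨ cong (_∸ y) (+-∸-comm b p) ⟩
    (i + j ∸ x) + b ∸ y     ≡⟨ +-∸-assoc (i + j ∸ x) q ⟩
    (i + j ∸ x) + (b ∸ y)   ∎)
    where open ≡-Reasoning

-- Existence of sum paths, by recursion on the number of labels

double-< : ∀ {a b n} → a < b → b + b ≤ suc n → a + a < n
double-< {a} {n = n} a<b q = subst (_≤ n) (+-suc a a) (s≤s⁻¹ (≤-trans (+-mono-≤ a<b a<b) q))

half-≤ : ∀ {i h} → i + i ≤ suc (h + h) → i ≤ h
half-≤ {i} {h} p with i ≤? h
... | yes q = q
... | no q = ⊥-elim (<-irrefl refl (double-< (≰⇒> q) p))

-- The first argument is fuel.
balanced : ∀ n {h i} → h + h ≤ n → i < h → SumPath h h i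
balanced< : ∀ n {h i} → h + h ≤ n → i + i < h → SumPath h h i
-- At h = 2i > 0 the reflection fixes the start, and either prefix would leave a low side of only
-- `i` labels, too few for the start `i`. In all four functions the fuel bounds the total number of
-- labels.
surplus : ∀ n {h i} → h + h < n → i ≤ h → (h ≡ i + i → i ≡ 0) → SumPath (suc h) h i
surplus< : ∀ n {h i} → h + h < n → i + i < h → SumPath (suc h) h i

balanced n {h} {i} p i<h with i + i <? h
... | yes q = balanced< n p q
-- Here 2i ≥ h, and the mirrored start `j` lies in the lower half.
balanced n {suc a} {i} p (s≤s i≤a) | no q with m≤n⇒∃[o]m+o≡n i≤a
... | j , refl = reflect (balanced< n p (s≤s (+-monoˡ-≤ j (<⇒≤ j<i))))
  where
  j<i : j < i
  j<i = +-cancelˡ-< i j i (≮⇒≥ q)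

balanced< zero {suc h} () q
balanced< (suc n) {h} {i} p q with m≤n⇒∃[o]m+o≡n q
-- `prefix-odd` comes from i + k + 1 low and i + k high labels, which can be the excluded shape only
-- if k = i.
... | k , refl with k ≟ i
... | no k≢i = subst₂ (λ l h → SumPath l h i) (lemma₁ i k) (lemma₂ i k)
      (prefix-odd (surplus n (double-< (s≤s (+-monoˡ-≤ k (m≤m+n i i))) p) (m≤m+n i k)
        (λ eq → ⊥-elim (k≢i (+-cancelˡ-≡ i k i eq)))))
  where
  lemma₁ : ∀ i k → i + k + suc i ≡ suc (i + i) + k
  lemma₁ = solve-∀
  lemma₂ : ∀ i k → suc (i + k) + i ≡ suc (i + i) + k
  lemma₂ = solve-∀
balanced< (suc n) {h} {zero} p q | k , refl | yes refl = prefix-odd single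
-- Now h = 3i + 1, and `prefix-even` avoids the excluded shape: it leaves 2i labels on each side.
balanced< (suc n) {h} {i@(suc _)} p q | k , refl | yes refl =
  subst (λ h → SumPath h h i) (+-suc (i + i) i)
    (prefix-even (balanced n (<⇒≤ (double-< (s≤s (m≤m+n (i + i) i)) p)) (m<m+n i (s≤s z≤n))))

surplus n {h} {i} p i≤h good with <-cmp (i + i) h
... | tri< q _ _ = surplus< n p q
-- At the centre `good` forces i = 0, hence h = 0.
... | tri≈ _ refl _ with refl ← good refl = single
... | tri> _ _ q with m≤n⇒∃[o]m+o≡n i≤h
surplus n {zero} {suc i} p () good | tri> _ _ q | _
surplus n {h@(suc _)} {i} p i≤h good | tri> _ _ q | j , eq =
  subst (λ k → SumPath (suc k) h i) eq (reflect (subst (λ k → SumPath (suc k) h j) (sym eq)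
    (surplus< n p (subst (j + j <_) eq (+-monoˡ-< j (+-cancelˡ-< i j i (subst (_< i + i) (sym eq) q)))))))

surplus< (suc n) {h} {i} (s≤s p) q with m≤n⇒∃[o]m+o≡n q
-- Taking away i + 1 low and i high labels leaves i + 1 + k on each side.
... | k , refl = subst₂ (λ l h → SumPath l h i) (lemma₁ i k) (lemma₂ i k)
      (prefix-odd (balanced n (≤-trans (+-mono-≤ r r) p) (m≤m+n (suc i) k)))
  where
  r : suc i + k ≤ suc (i + i) + k
  r = s≤s (+-monoˡ-≤ k (m≤m+n i i))
  lemma₁ : ∀ i k → suc i + k + suc i ≡ suc (suc (i + i) + k)
  lemma₁ = solve-∀
  lemma₂ : ∀ i k → suc i + k + i ≡ suc (i + i) + k
  lemma₂ = solve-∀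

-- Graceful paths from every start

record Graceful (N i : ℕ) : Set where
  constructor graceful
  field
    {tail} : List ℕ
    labels : i ∷ tail ↭ downFrom (suc N)
    diffs : steps ∣_-_∣ (i ∷ tail) ↭ map suc (downFrom N)

-- The labels x and N - y differ by N - (x + y) up to sign. The absolute value also covers sums
-- above `N`, which occur in `graceful-quarter`.
diffs-label : ∀ {N xs} → All (_≤ N) (odds xs) →
  steps ∣_-_∣ (alternate id (N ∸_) xs) ≡ map ∣_- N ∣ (steps _+_ xs)
diffs-label {N} = steps-alternate {P = U} ∣_- N ∣ (λ {x} _ → eq x)
  (λ {x} {y} _ q → ≡.trans (∣-∣-comm (N ∸ y) x) (≡.trans (eq x q) (cong ∣_- N ∣ (+-comm x y))))
  (All.universal-U _)
  where
  eq : ∀ x {y} → y ≤ N → ∣ x - N ∸ y ∣ ≡ ∣ x + y - N ∣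
  eq x {y} q with m≤n⇒∃[o]m+o≡n q
  ... | c , refl = ≡.trans (cong (∣ x -_∣) (m+n∸m≡n y c))
    (≡.trans (sym (∣m+n-m+o∣≡∣n-o∣ y x c)) (cong (∣_- y + c ∣) (+-comm y x)))

vertices-label : ∀ {N} (xs : List ℕ) → alternate id (N ∸_) xs ↭ evens xs ++ map (N ∸_) (odds xs)
vertices-label {N} xs = trans (↭-sym (evens++odds _)) (↭-reflexive
  (cong₂ _++_ (≡.trans (evens-alternate id (N ∸_) xs) (map-id _)) (odds-alternate id (N ∸_) xs)))

diff-downFrom : ∀ {N} c k → suc N ≡ suc c + k →
  map ∣_- N ∣ (downFrom k) ↭ map (suc c +_) (downFrom k)
diff-downFrom {N} c k eq = trans (↭-reflexive (map-cong-local (All.map (λ x<k →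
    m≤n⇒∣m-n∣≡n∸m (≤-trans (<⇒≤ x<k) (≤-trans (m≤n+m k c) (≤-reflexive (sym (suc-injective eq))))))
    (downFrom-bounded k))))
  (map-reflect-downFrom (suc c) k eq)

-- The high labels reflect onto l ... N, just above the low ones, and the sums 0 ... N - 1 become
-- the differences N ... 1.
fromSumPath : ∀ {l h N i} → l + h ≡ suc N → SumPath l h i → Graceful N i
fromSumPath {l} {h} {N} {i} eq (sumPath {t} c lo hi s) with refl ← suc-injective (≡.trans (sym c) eq) =
  graceful
    (trans (vertices-label (i ∷ t)) (trans (++⁺ lo (trans (map⁺ (N ∸_) hi) (map-reflect-downFrom l h (sym eq))))
      (trans (downFrom-extend h l refl) (↭-reflexive (cong downFrom (≡.trans (+-comm h l) eq))))))
    (trans (↭-reflexive (diffs-label (All.map (λ y<h → s≤s⁻¹ (≤-trans y<h (≤-trans (m≤n+m h l) (≤-reflexive eq)))) (bounded hi))))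
      (trans (map⁺ _ s) (diff-downFrom 0 N refl)))

reflect-graceful : ∀ {i j} → Graceful (i + j) j → Graceful (i + j) i
reflect-graceful {i} {j} (graceful {t} ls ds) = subst (Graceful (i + j)) (m+n∸n≡m i j)
  (graceful (reflect-downFrom (i + j) ls)
    (trans (↭-reflexive (≡.trans (steps-map {_∙_ = ∣_-_∣} id eq (bounded ls)) (map-id _))) ds))
  where
  eq : ∀ {x y} → x < suc (i + j) → y < suc (i + j) → ∣ i + j ∸ x - i + j ∸ y ∣ ≡ ∣ x - y ∣
  eq {x} {y} (s≤s p) (s≤s q) = begin
    ∣ n ∸ x - n ∸ y ∣                      ≡⟨ ∣m+n-m+o∣≡∣n-o∣ x (n ∸ x) (n ∸ y) ⟨
    ∣ x + (n ∸ x) - x + (n ∸ y) ∣          ≡⟨ cong (∣_- x + (n ∸ y) ∣) (≡.trans (m+[n∸m]≡n p) (sym (m+[n∸m]≡n q))) ⟩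
    ∣ y + (n ∸ y) - x + (n ∸ y) ∣          ≡⟨ cong₂ ∣_-_∣ (+-comm y _) (+-comm x _) ⟩
    ∣ (n ∸ y) + y - (n ∸ y) + x ∣          ≡⟨ ∣m+n-m+o∣≡∣n-o∣ (n ∸ y) y x ⟩
    ∣ y - x ∣                              ≡⟨ ∣-∣-comm y x ⟩
    ∣ x - y ∣                              ∎
    where
    open ≡-Reasoning
    n = i + j

-- The exceptional case: the prefix i, i−1, i−1, …, 0, 0 uses up the differences above 2i, and is
-- followed by an alternating path on the middle interval, whose sums lie above N = 4i.
graceful-quarter : ∀ {i} → 0 < i → Graceful (i + i + (i + i)) i
graceful-quarter {i} 0<i with balanced (i + i) ≤-refl 0<i
... | sumPath {t} {e} c lo hi s = graceful
  (trans (vertices-label p) (trans (++⁺ lows (trans (map⁺ (N ∸_) highs) highs′)) regroup))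
  (begin
    steps ∣_-_∣ (alternate id (N ∸_) p)
      ≡⟨ diffs-label {xs = p} (All-resp-↭ (↭-sym highs) (All.++⁺
          (All.map (λ x<i → ≤-trans (<⇒≤ x<i) (≤-trans (m≤m+n i i) (m≤m+n (i + i) (i + i)))) (downFrom-bounded i))
          (All.map⁺ (All.map (λ x<i → +-monoʳ-≤ (i + i) (≤-trans (<⇒≤ x<i) (m≤m+n i i))) (downFrom-bounded i))))) ⟩
    map ∣_- N ∣ (steps _+_ p)
      ≡⟨ cong (map ∣_- N ∣) (≡.trans (sums-ladder i (i + i + 0) _)
          (cong (λ q → downFrom (i + i) ++ (i + i + 0) ∷ q) (sums-shift (i + i) (suc (i + i)) (0 ∷ t)))) ⟩
    map ∣_- N ∣ (downFrom (i + i) ++ (i + i + 0) ∷ map (i + i + suc (i + i) +_) z)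
      ≡⟨ map-++ ∣_- N ∣ (downFrom (i + i)) _ ⟩
    map ∣_- N ∣ (downFrom (i + i)) ++ ∣ i + i + 0 - N ∣ ∷ map ∣_- N ∣ (map (i + i + suc (i + i) +_) z)
      ≡⟨ cong₂ (λ x xs → map ∣_- N ∣ (downFrom (i + i)) ++ x ∷ xs)
          (∣m+n-m+o∣≡∣n-o∣ (i + i) 0 (i + i))
          (≡.trans (sym (map-∘ z)) (map-cong beyond z)) ⟩
    -- The joining edge has difference 2i; the middle path provides the smaller ones.
    map ∣_- N ∣ (downFrom (i + i)) ++ i + i ∷ map suc z
      ↭⟨ ++⁺ (diff-downFrom (i + i) (i + i) refl) (prep (i + i) (map⁺ suc s)) ⟩
    map (suc (i + i) +_) (downFrom (i + i)) ++ i + i ∷ map suc (downFrom e)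
      ≡⟨ cong₂ _++_ (map-∘ (downFrom (i + i))) (cong (_∷ map suc (downFrom e)) c) ⟩
    map suc (map (i + i +_) (downFrom (i + i))) ++ map suc (downFrom (suc e))
      ≡⟨ cong (λ k → map suc (map (i + i +_) (downFrom (i + i))) ++ map suc (downFrom k)) c ⟨
    map suc (map (i + i +_) (downFrom (i + i))) ++ map suc (downFrom (i + i))
      ≡⟨ map-++ suc (map (i + i +_) (downFrom (i + i))) _ ⟨
    map suc (map (i + i +_) (downFrom (i + i)) ++ downFrom (i + i))
      ≡⟨ cong (map suc) (map-+-downFrom (i + i) (i + i)) ⟩
    map suc (downFrom N) ∎)
  where
  open PermutationReasoning
  N = i + i + (i + i)
  -- The middle path enters on the high side, where its labels are i + 1 ... 2i; on the low side
  -- they are 2i + 1 ... 3i. Its sums are moved up by 4i + 1.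
  r = alternate (i + i +_) (suc (i + i) +_) (0 ∷ t)
  p = i ∷ ladder i ++ r
  z = steps _+_ (0 ∷ t)
  lows : evens p ↭ downFrom (suc i) ++ map (suc (i + i) +_) (downFrom i)
  lows = prep i (trans (↭-reflexive (≡.trans (odds-ladder i r)
    (cong (downFrom i ++_) (odds-alternate (i + i +_) (suc (i + i) +_) (0 ∷ t)))))
    (++⁺ˡ (downFrom i) (map⁺ _ hi)))
  highs : odds p ↭ downFrom i ++ map (i + i +_) (downFrom i)
  highs = trans (↭-reflexive (≡.trans (evens-ladder i r)
    (cong (downFrom i ++_) (evens-alternate (i + i +_) (suc (i + i) +_) (0 ∷ t)))))
    (++⁺ˡ (downFrom i) (map⁺ _ lo))
  highs′ : map (N ∸_) (downFrom i ++ map (i + i +_) (downFrom i)) ↭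
    map (i + (suc (i + i)) +_) (downFrom i) ++ map (suc i +_) (downFrom i)
  highs′ = trans (↭-reflexive (≡.trans (map-++ (N ∸_) (downFrom i) _)
      (cong (map (N ∸_) (downFrom i) ++_)
        (≡.trans (sym (map-∘ (downFrom i))) (map-cong ([m+n]∸[m+o]≡n∸o (i + i) (i + i)) (downFrom i))))))
    (++⁺ (map-reflect-downFrom (i + suc (i + i)) i (eq i)) (map-reflect-downFrom (suc i) i refl))
    where
    eq : ∀ i → suc (i + i + (i + i)) ≡ i + suc (i + i) + i
    eq = solve-∀
  -- Above 0 ... i come the blocks `A` = i + 1 ... 2i, `B` = 2i + 1 ... 3i and `C` = 3i + 1 ... 4i.
  regroup : (downFrom (suc i) ++ map (suc (i + i) +_) (downFrom i)) ++
    (map (i + (suc (i + i)) +_) (downFrom i) ++ map (suc i +_) (downFrom i)) ↭ downFrom (suc N)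
  regroup = begin
    (downFrom (suc i) ++ B) ++ (C ++ A)   ↭⟨ ++-comm _ (C ++ A) ⟩
    (C ++ A) ++ (downFrom (suc i) ++ B)   ≡⟨ ++-assoc C A _ ⟩
    C ++ (A ++ (downFrom (suc i) ++ B))   ≡⟨ cong (C ++_) (++-assoc A _ B) ⟨
    C ++ ((A ++ downFrom (suc i)) ++ B)   ≡⟨ cong (λ xs → C ++ (xs ++ B)) (≡.trans (map-+-downFrom i (suc i)) (cong downFrom (+-suc i i))) ⟩
    C ++ (downFrom (suc (i + i)) ++ B)    ↭⟨ ++⁺ˡ C (downFrom-extend i (suc (i + i)) refl) ⟩
    C ++ downFrom (i + suc (i + i))       ≡⟨ map-+-downFrom i (i + suc (i + i)) ⟩
    downFrom (i + (i + suc (i + i)))      ≡⟨ cong downFrom (eq i) ⟩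
    downFrom (suc N)                      ∎
    where
    A = map (suc i +_) (downFrom i)
    B = map (suc (i + i) +_) (downFrom i)
    C = map (i + (suc (i + i)) +_) (downFrom i)
    eq : ∀ i → i + (i + suc (i + i)) ≡ suc (i + i + (i + i))
    eq = solve-∀
  beyond : ∀ x → ∣ i + i + suc (i + i) + x - N ∣ ≡ suc x
  beyond x = ≡.trans (cong ∣_- N ∣ (≡.trans (cong (_+ x) (+-suc (i + i) (i + i))) (sym (+-suc N x))))
    (≡.trans (∣-∣-comm (N + suc x) N) (∣m-m+n∣≡n N (suc x)))

-- The parity of `N` decides between equal sides and one surplus low label. Only N = 4i meets the
-- excluded shape; `graceful-quarter` settles it for positive i.
graceful-low : ∀ {N i} → i + i ≤ N → Graceful N i
graceful-low {N} p with halve N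
  where
  halve : ∀ n → ∃ λ h → n ≡ h + h ⊎ n ≡ suc (h + h)
  halve zero = 0 , inj₁ refl
  halve (suc n) with halve n
  ... | h , inj₁ eq = h , inj₂ (cong suc eq)
  ... | h , inj₂ eq = suc h , inj₁ (cong suc (≡.trans eq (sym (+-suc h h))))
graceful-low {N} {i} p | h , inj₂ refl =
  fromSumPath (cong suc (+-suc h h)) (balanced (suc h + suc h) ≤-refl (s≤s (half-≤ p)))
graceful-low {N} {i} p | h , inj₁ refl with h ≟ i + i
... | no ¬eq = fromSumPath refl (surplus (suc (h + h)) ≤-refl (half-≤ (m≤n⇒m≤1+n p)) (λ eq → ⊥-elim (¬eq eq)))
graceful-low {N} {zero} p | h , inj₁ refl | yes refl = graceful refl refl
graceful-low {N} {suc j} p | h , inj₁ refl | yes refl = graceful-quarter (s≤s z≤n)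

graceful-from : ∀ {N i} → i ≤ N → Graceful N i
graceful-from {i = i} i≤N with m≤n⇒∃[o]m+o≡n i≤N
... | j , refl with i ≤? j
... | yes i≤j = graceful-low (+-monoʳ-≤ i i≤j)
... | no i≰j = reflect-graceful (graceful-low (+-monoˡ-≤ j (<⇒≤ (≰⇒> i≰j))))

-- Joining two segments, and edge lengths on the cycle

steps-ʳ++ : {_∙_ : X → X → ℕ} → (∀ x y → x ∙ y ≡ y ∙ x) → ∀ x xs y ys →
  steps _∙_ ((x ∷ xs) ʳ++ (y ∷ ys)) ↭ steps _∙_ (x ∷ xs) ++ (x ∙ y) ∷ steps _∙_ (y ∷ ys)
steps-ʳ++ comm x [] y ys = refl
steps-ʳ++ {_∙_ = _∙_} comm x (x′ ∷ xs) y ys =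
  trans (steps-ʳ++ {_∙_ = _∙_} comm x′ xs x (y ∷ ys))
    (trans (shift (x′ ∙ x) (steps _∙_ (x′ ∷ xs)) _) (↭-reflexive (cong (_∷ steps _∙_ (x′ ∷ xs) ++ (x ∙ y) ∷ steps _∙_ (y ∷ ys)) (comm x′ x))))

ʳ++-↭ : (xs ys : List X) → xs ʳ++ ys ↭ xs ++ ys
ʳ++-↭ xs ys = trans (↭-reflexive (ʳ++-defn xs)) (++⁺ʳ ys (↭-reverse xs))

cyclic : ℕ → ℕ → ℕ
cyclic v d = d ⊓ (v ∸ d)

edge : ℕ → ℕ → ℕ → ℕ
edge v x y = cyclic v ∣ x - y ∣

edge-comm : ∀ v x y → edge v x y ≡ edge v y x
edge-comm v x y = cong (cyclic v) (∣-∣-comm x y)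

cyclic-short : ∀ {v d} → d + d ≤ v → cyclic v d ≡ d
cyclic-short p = m≤n⇒m⊓n≡m (m+n≤o⇒m≤o∸n _ p)

lengths-steps : ∀ {v} (p : List (Fin v)) → lengths v p ≡ steps (edge v) (map toℕ p)
lengths-steps [] = refl
lengths-steps (x ∷ []) = refl
lengths-steps (x ∷ y ∷ p) = cong (_ ∷_) (lengths-steps (y ∷ p))

allFin-downFrom : ∀ v → map toℕ (allFin v) ↭ downFrom v
allFin-downFrom v = trans (↭-reflexive (≡.trans (map-tabulate id toℕ) (tabulate-toℕ v id)))
  (trans (↭-sym (↭-reverse (upTo v))) (↭-reflexive (reverse-upTo v)))
  where
  tabulate-toℕ : ∀ n (f : ℕ → ℕ) → tabulate {n = n} (f ∘ toℕ) ≡ applyUpTo f n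
  tabulate-toℕ zero f = refl
  tabulate-toℕ (suc n) f = cong (f 0 ∷_) (tabulate-toℕ n (f ∘ suc))

-- A permutation of 0 ... v - 1 lifts along `toℕ`, so paths can be built from plain numbers.
realize : ∀ {v p L} → p ↭ downFrom v → steps (edge v) p ↭ L → Realizable v L
realize {v} visits steps↭L with ↭-map-inv toℕ (↭-sym (trans visits (↭-sym (allFin-downFrom v))))
... | q , refl , all↭q = (q , ↭-sym all↭q) , trans (↭-reflexive (lengths-steps q)) steps↭L

-- Lengths within a segment, and the target lists

positives : ℕ → List ℕ
positives n = map suc (downFrom n)

-- As 2N ≤ v, no difference exceeds v/2, so each cyclic length is the difference itself.
steps-segment : ∀ {v N i} c → N + N ≤ v → (G : Graceful N i) →
  steps (edge v) (map (c +_) (i ∷ Graceful.tail G)) ↭ positives N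
steps-segment {v} {N} c short (graceful {t} _ ds) = trans
  (↭-reflexive (steps-map {P = U} (cyclic v) (λ {x} {y} _ _ → cong (cyclic v) (∣m+n-m+o∣≡∣n-o∣ c x y)) (All.universal-U _)))
  (trans (map⁺ (cyclic v) ds) (↭-reflexive (≡.trans (sym (map-∘ (downFrom N)))
    (map-cong-local (All.map (λ x<N → cyclic-short (≤-trans (+-mono-≤ x<N x<N) short)) (downFrom-bounded N))))))

pairsUpTo-positives : ∀ n → pairsUpTo n ↭ positives n ++ positives n
pairsUpTo-positives zero = refl
pairsUpTo-positives (suc n) = trans (++⁺ʳ _ (pairsUpTo-positives n))
  (trans (++-comm (positives n ++ positives n) (suc n ∷ suc n ∷ []))
    (prep (suc n) (↭-sym (shift (suc n) (positives n) (positives n)))))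

gather : ∀ n ls → positives n ++ (ls ++ positives n) ↭ pairsUpTo n ++ ls
gather n ls = trans (++⁺ˡ (positives n) (++-comm ls (positives n)))
  (trans (↭-reflexive (sym (++-assoc (positives n) (positives n) ls)))
    (++⁺ʳ ls (↭-sym (pairsUpTo-positives n))))

pairsUpTo-≤ : ∀ n → All (_≤ n) (pairsUpTo n)
pairsUpTo-≤ zero = []
pairsUpTo-≤ (suc n) = All.++⁺ (All.map m≤n⇒m≤1+n (pairsUpTo-≤ n)) (≤-refl ∷ ≤-refl ∷ [])

delete-here : ∀ x ys → delete x (x ∷ ys) ≡ ys
delete-here x ys with x ≟ x
... | yes _ = refl
... | no x≢x = ⊥-elim (x≢x refl)

delete-++ : ∀ {x xs} ys → All (_< x) xs → delete x (xs ++ ys) ≡ xs ++ delete x ys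
delete-++ ys [] = refl
delete-++ {x} {y ∷ xs} ys (y<x ∷ p) with x ≟ y
... | yes refl = ⊥-elim (<-irrefl refl y<x)
... | no _ = cong (y ∷_) (delete-++ ys p)

-- The pairs are listed in increasing order, so deletion passes only strictly smaller entries before
-- it meets the last pair. `ys` makes room for the single `m` of the even case.
delete-pair : ∀ n ys → delete (suc n) (delete (suc n) (pairsUpTo (suc n) ++ ys)) ≡ pairsUpTo n ++ ys
delete-pair n ys = begin
  del (del ((pairsUpTo n ++ suc n ∷ suc n ∷ []) ++ ys)) ≡⟨ cong (del ∘ del) (++-assoc (pairsUpTo n) _ ys) ⟩
  del (del (pairsUpTo n ++ suc n ∷ suc n ∷ ys))         ≡⟨ cong del (delete-++ _ small) ⟩
  del (pairsUpTo n ++ del (suc n ∷ suc n ∷ ys))         ≡⟨ delete-++ _ small ⟩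
  pairsUpTo n ++ del (del (suc n ∷ suc n ∷ ys))         ≡⟨ cong (λ zs → pairsUpTo n ++ del zs) (delete-here (suc n) _) ⟩
  pairsUpTo n ++ del (suc n ∷ ys)                       ≡⟨ cong (pairsUpTo n ++_) (delete-here (suc n) ys) ⟩
  pairsUpTo n ++ ys                                     ∎
  where
  open ≡-Reasoning
  del = delete (suc n)
  small : All (_< suc n) (pairsUpTo n)
  small = All.map s≤s (pairsUpTo-≤ n)

-- The Hamiltonian paths for odd and even order

realize-odd : ∀ m z₁ z₂ → 1 ≤ z₁ → z₁ < m → 1 ≤ z₂ → z₂ < m →
  Realizable (suc (m + m)) (replaceTwo (LstarOdd m) m z₁ z₂)
realize-odd m@(suc N) z₁@(suc a) z₂@(suc c) _ (s≤s z₁≤N) _ (s≤s z₂≤N) =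
  -- The two graceful segments cover m + 1 ... 2m and 1 ... m, and both have their starts next to 0.
  realize {p = backward ʳ++ (0 ∷ forward)}
    (begin
      backward ʳ++ (0 ∷ forward)
        ↭⟨ ʳ++-↭ backward (0 ∷ forward) ⟩
      backward ++ 0 ∷ forward
        ↭⟨ ++⁺ (map⁺ _ (Graceful.labels B)) (prep 0 (map⁺ suc (Graceful.labels A))) ⟩
      map (suc m +_) (downFrom m) ++ 0 ∷ map suc (downFrom m)
        ↭⟨ ++⁺ˡ (map (suc m +_) (downFrom m)) (++-comm (0 ∷ []) (map suc (downFrom m))) ⟩
      map (suc m +_) (downFrom m) ++ (map suc (downFrom m) ++ 0 ∷ [])
        ≡⟨ cong (map (suc m +_) (downFrom m) ++_) (map-+-downFrom m 1) ⟩
      map (suc m +_) (downFrom m) ++ downFrom (m + 1)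
        ≡⟨ cong (λ k → map (suc m +_) (downFrom m) ++ downFrom k) (+-comm m 1) ⟩
      map (suc m +_) (downFrom m) ++ downFrom (suc m)
        ≡⟨ map-+-downFrom m (suc m) ⟩
      downFrom (m + suc m)
        ≡⟨ cong downFrom (+-suc m m) ⟩
      downFrom v ∎)
    (begin
      steps (edge v) (backward ʳ++ (0 ∷ forward))
        ↭⟨ steps-ʳ++ (edge-comm v) _ _ 0 forward ⟩
      steps (edge v) backward ++ edge v (suc m + b) 0 ∷ edge v 0 z₁ ∷ steps (edge v) forward
        ↭⟨ ++⁺ (steps-segment (suc m) short B) (↭-reflexive (cong₂ _∷_ long refl)) ⟩
      positives N ++ z₂ ∷ edge v 0 z₁ ∷ steps (edge v) forward
        ↭⟨ ++⁺ˡ (positives N) (prep z₂ (↭-reflexive (cong (_∷ steps (edge v) forward) (cyclic-short z₁-short)))) ⟩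
      positives N ++ z₂ ∷ z₁ ∷ steps (edge v) forward
        ↭⟨ ++⁺ˡ (positives N) (swap z₂ z₁ (steps-segment 1 short A)) ⟩
      positives N ++ (z₁ ∷ z₂ ∷ []) ++ positives N
        ↭⟨ gather N (z₁ ∷ z₂ ∷ []) ⟩
      pairsUpTo N ++ z₁ ∷ z₂ ∷ []
        ≡⟨ cong (_++ z₁ ∷ z₂ ∷ []) deleted ⟨
      replaceTwo (LstarOdd m) m z₁ z₂ ∎)
  where
  open PermutationReasoning
  v = suc (m + m)
  -- With this choice the neighbour of 0 in the upper interval is v - z₂.
  b = N ∸ c
  A : Graceful N a
  A = graceful-from (<⇒≤ z₁≤N)
  B : Graceful N b
  B = graceful-from (m∸n≤m N c)
  forward = map suc (a ∷ Graceful.tail A)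
  backward = map (suc m +_) (b ∷ Graceful.tail B)
  short : N + N ≤ v
  short = ≤-trans (+-mono-≤ (n≤1+n N) (n≤1+n N)) (n≤1+n (m + m))
  z₁-short : z₁ + z₁ ≤ v
  z₁-short = ≤-trans (+-mono-≤ z₁≤N z₁≤N) short
  long : edge v (suc m + b) 0 ≡ z₂
  -- This edge wraps around: the minimum is attained by `v ∸ (suc m + b)`.
  long = ≡.trans (m≥n⇒m⊓n≡n (≤-trans (≤-reflexive rest) (≤-trans (m≤n⇒m≤1+n (m≤n⇒m≤1+n z₂≤N)) (m≤m+n (suc m) b)))) rest
    where
    rest : v ∸ (suc m + b) ≡ z₂
    rest = ≡.trans ([m+n]∸[m+o]≡n∸o m m b) (m∸[m∸n]≡n {m} {z₂} (m≤n⇒m≤1+n z₂≤N))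
  deleted : delete m (delete m (LstarOdd m)) ≡ pairsUpTo N
  deleted = ≡.trans (cong (delete m ∘ delete m) (sym (++-identityʳ (pairsUpTo m))))
    (≡.trans (delete-pair N []) (++-identityʳ (pairsUpTo N)))

realize-even : ∀ m z₁ z₂ → 1 ≤ z₁ → z₁ < m ∸ 1 → 1 ≤ z₂ → z₂ < m ∸ 1 →
  Realizable (m + m) (replaceTwo (LstarEven m) (m ∸ 1) z₁ z₂)
realize-even m@(suc (suc N)) z₁@(suc a) z₂@(suc c) _ (s≤s z₁≤N) _ (s≤s z₂≤N) =
  -- The edge from 0 to `m` gives the single length m. The segments on 1 ... m - 1 and m + 1 ... 2m
  -- - 1 are attached at z₁ and at m + z₂.
  realize {p = backward ʳ++ (0 ∷ m ∷ forward)}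
    (begin
      backward ʳ++ (0 ∷ m ∷ forward)
        ↭⟨ ʳ++-↭ backward (0 ∷ m ∷ forward) ⟩
      backward ++ 0 ∷ m ∷ forward
        ↭⟨ ++⁺ (map⁺ suc (Graceful.labels A)) (prep 0 (prep m (map⁺ _ (Graceful.labels B)))) ⟩
      map suc (downFrom (suc N)) ++ (0 ∷ m ∷ []) ++ map (suc m +_) (downFrom (suc N))
        ≡⟨ ++-assoc (map suc (downFrom (suc N))) (0 ∷ m ∷ []) _ ⟨
      (map suc (downFrom (suc N)) ++ 0 ∷ m ∷ []) ++ map (suc m +_) (downFrom (suc N))
        ↭⟨ ++⁺ʳ _ (trans (↭-reflexive (sym (++-assoc (map suc (downFrom (suc N))) (0 ∷ []) (m ∷ []))))
             (trans (++-comm _ (m ∷ []))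
               (prep m (↭-reflexive (≡.trans (map-+-downFrom (suc N) 1) (cong downFrom (+-comm (suc N) 1))))))) ⟩
      downFrom (suc m) ++ map (suc m +_) (downFrom (suc N))
        ↭⟨ downFrom-extend (suc N) (suc m) refl ⟩
      downFrom (suc N + suc m)
        ≡⟨ cong downFrom (+-suc (suc N) m) ⟩
      downFrom v ∎)
    (begin
      steps (edge v) (backward ʳ++ (0 ∷ m ∷ forward))
        ↭⟨ steps-ʳ++ (edge-comm v) _ _ 0 (m ∷ forward) ⟩
      steps (edge v) backward ++ edge v z₁ 0 ∷ edge v 0 m ∷ edge v m (suc m + c) ∷ steps (edge v) forward
        ↭⟨ ++⁺ (steps-segment 1 short A) (↭-reflexive (cong₂ _∷_ (cyclic-short z₁-short)
             (cong₂ _∷_ (cyclic-short {v} {m} ≤-refl) (cong (_∷ steps (edge v) forward) m-z₂)))) ⟩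
      positives N ++ z₁ ∷ m ∷ z₂ ∷ steps (edge v) forward
        ↭⟨ ++⁺ˡ (positives N) (swap z₁ m (prep z₂ (steps-segment (suc m) short B))) ⟩
      positives N ++ (m ∷ z₁ ∷ z₂ ∷ []) ++ positives N
        ↭⟨ gather N (m ∷ z₁ ∷ z₂ ∷ []) ⟩
      pairsUpTo N ++ m ∷ z₁ ∷ z₂ ∷ []
        ≡⟨ ++-assoc (pairsUpTo N) (m ∷ []) _ ⟨
      (pairsUpTo N ++ m ∷ []) ++ z₁ ∷ z₂ ∷ []
        ≡⟨ cong (_++ z₁ ∷ z₂ ∷ []) (delete-pair N (m ∷ [])) ⟨
      replaceTwo (LstarEven m) (m ∸ 1) z₁ z₂ ∎)
  where
  open PermutationReasoning
  v = m + m
  A : Graceful N a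
  A = graceful-from (<⇒≤ z₁≤N)
  B : Graceful N c
  B = graceful-from (<⇒≤ z₂≤N)
  backward = map suc (a ∷ Graceful.tail A)
  forward = map (suc m +_) (c ∷ Graceful.tail B)
  N≤m : N ≤ m
  N≤m = ≤-trans (n≤1+n N) (n≤1+n (suc N))
  short : N + N ≤ v
  short = +-mono-≤ N≤m N≤m
  z₁-short : z₁ + z₁ ≤ v
  z₁-short = ≤-trans (+-mono-≤ z₁≤N z₁≤N) short
  m-z₂ : edge v m (suc m + c) ≡ z₂
  m-z₂ = ≡.trans (cong (cyclic v) (≡.trans (cong (∣ m -_∣) (sym (+-suc m c))) (∣m-m+n∣≡n m z₂)))
    (cyclic-short (≤-trans (+-mono-≤ z₂≤N z₂≤N) short))

-- Necessity of the divisor condition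

∣-cyclic : ∀ {d v k} → d ∣ v → k ≤ v → d ∣ cyclic v k → d ∣ k
∣-cyclic {d} {v} {k} d∣v k≤v p with ⊓-sel k (v ∸ k)
... | inj₁ eq = subst (d ∣_) eq p
... | inj₂ eq = ∣m+n∣m⇒∣n (subst (d ∣_) (sym (m∸n+n≡m k≤v)) d∣v) (subst (d ∣_) eq p)

%-∣-∣ : ∀ {d} .{{_ : NonZero d}} x y → d ∣ ∣ x - y ∣ → x % d ≡ y % d
%-∣-∣ {d} x y p with ≤-total x y
... | inj₁ x≤y = sym (≡.trans (cong (_% d) (sym (m+[n∸m]≡n x≤y)))
  (%-remove-+ʳ x (subst (d ∣_) (m≤n⇒∣m-n∣≡n∸m x≤y) p)))
... | inj₂ y≤x = ≡.trans (cong (_% d) (sym (m+[n∸m]≡n y≤x)))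
  (%-remove-+ʳ y (subst (d ∣_) (≡.trans (∣-∣-comm x y) (m≤n⇒∣m-n∣≡n∸m y≤x)) p))

-- An edge whose length is a multiple of `d` joins equal residues, so only the other edges can bring
-- in a new one. Each vertex thus accounts for one listed residue or one counted edge.
residues : ∀ {d v} .{{_ : NonZero d}} → d ∣ v → (x : Fin v) (xs : List (Fin v)) →
  ∃ λ rs → (∀ {y} → y ∈ x ∷ xs → toℕ y % d ∈ rs) ×
    length rs + countMult d (lengths v (x ∷ xs)) ≤ length (x ∷ xs)
residues {d} d∣v x [] = (toℕ x % d ∷ []) , (λ { (here refl) → here refl }) , ≤-refl
residues {d} {v} d∣v x (y ∷ xs) with residues d∣v y xs | d ∣? edgeLen v x y
... | rs , covers , bound | yes d∣e =
  rs ,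
  (λ { (here refl) → subst (_∈ rs) (sym same) (covers (here refl)) ; (there p) → covers p }) ,
  subst (_≤ suc (suc (length xs))) (sym (+-suc (length rs) _)) (s≤s bound)
  where
  distance≤v : ∣ toℕ x - toℕ y ∣ ≤ v
  distance≤v = ≤-trans (∣m-n∣≤m⊔n (toℕ x) (toℕ y)) (⊔-lub (<⇒≤ (toℕ<n x)) (<⇒≤ (toℕ<n y)))
  same : toℕ x % d ≡ toℕ y % d
  same = %-∣-∣ (toℕ x) (toℕ y) (∣-cyclic d∣v distance≤v d∣e)
... | rs , covers , bound | no d∤e =
  toℕ x % d ∷ rs , (λ { (here refl) → here refl ; (there p) → there (covers p) }) , s≤s bound

-- Pigeonhole: different residues are found at different positions of `rs`.
covering-length : ∀ {d rs} → (∀ {r} → r < d → r ∈ rs) → d ≤ length rs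
covering-length {d} {rs} covers = injective⇒≤ {f = λ i → index (covers (toℕ<n i))} λ {i} {j} eq →
  toℕ-injective (≡.trans (lookup-index (covers (toℕ<n i)))
    (≡.trans (cong (lookup rs) eq) (sym (lookup-index (covers (toℕ<n j))))))

realizable⇒countMult : ∀ {v L} .{{_ : NonZero v}} → Realizable v L →
  ∀ d → d ∣ v → countMult d L ≤ v ∸ d
realizable⇒countMult {suc v} _ zero d∣v with () ← 0∣⇒≡0 d∣v
realizable⇒countMult {suc v} (([] , visits) , _) (suc d) d∣v with () ← ↭-length visits
realizable⇒countMult {v@(suc _)} {L} ((x ∷ xs , visits) , realizes) d@(suc _) d∣v with residues d∣v x xs
... | rs , covers , bound = m+n≤o⇒m≤o∸n (countMult d L) (begin
  countMult d L + d                               ≡⟨ +-comm (countMult d L) d ⟩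
  d + countMult d L                               ≤⟨ +-mono-≤ (covering-length covers-all)
                                                       (≤-reflexive (↭-length (filter-↭ (d ∣?_) (↭-sym realizes)))) ⟩
  length rs + countMult d (lengths v (x ∷ xs))    ≤⟨ bound ⟩
  length (x ∷ xs)                                 ≡⟨ ↭-length visits ⟩
  length (allFin v)                               ≡⟨ length-tabulate id ⟩
  v                                               ∎)
  where
  open ≤-Reasoning
  covers-all : ∀ {r} → r < d → r ∈ rs
  -- Since d ≤ v, the number `r` is itself a vertex, and the path visits it.
  covers-all {r} r<d = subst (_∈ rs)
    (≡.trans (cong (_% d) (toℕ-fromℕ< r<v)) (m<n⇒m%n≡m r<d))
    (covers (∈-resp-↭ (↭-sym visits) (∈-allFin (fromℕ< r<v))))
    where
    r<v = <-≤-trans r<d (∣⇒≤ d∣v)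

-- Once a path is known, one direction is constant and the other is the counting bound.
realizable⇒BHR : ∀ {v L} .{{_ : NonZero v}} → Realizable v L → BHR v L × Realizable v L
realizable⇒BHR R = mk⇔ realizable⇒countMult (λ _ → R) , R

theorem6p4 : ((m z₁ z₂ : ℕ) → 1 ≤ z₁ → z₁ < m → 1 ≤ z₂ → z₂ < m →
    BHR (2 * m + 1) (replaceTwo (LstarOdd m) m z₁ z₂)
    × Realizable (2 * m + 1) (replaceTwo (LstarOdd m) m z₁ z₂))
    ×
    ((m z₁ z₂ : ℕ) → 1 ≤ z₁ → z₁ < m ∸ 1 → 1 ≤ z₂ → z₂ < m ∸ 1 →
    BHR (2 * m) (replaceTwo (LstarEven m) (m ∸ 1) z₁ z₂)
    × Realizable (2 * m) (replaceTwo (LstarEven m) (m ∸ 1) z₁ z₂))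
theorem6p4 =
  (λ { m@(suc _) z₁ z₂ p q p′ q′ → realizable⇒BHR
       (subst (λ v → Realizable v (replaceTwo (LstarOdd m) m z₁ z₂)) (odd m) (realize-odd m z₁ z₂ p q p′ q′)) }) ,
  (λ { m@(suc _) z₁ z₂ p q p′ q′ → realizable⇒BHR
       (subst (λ v → Realizable v (replaceTwo (LstarEven m) (m ∸ 1) z₁ z₂)) (even m) (realize-even m z₁ z₂ p q p′ q′)) })
  where
  odd : ∀ m → suc (m + m) ≡ 2 * m + 1
  odd = solve-∀
  even : ∀ m → m + m ≡ 2 * m
  even = solve-∀
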